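{- Let $n\ge 1$ and let $H$ be a ladder of height $n$. Then $H$ admits a Hagemann-Mitschke chain of conservative polymorphisms of length $n+1$, but does not admit a Hagemann-Mitschke chain of conservative polymorphisms of length $n$.
   Context: A ladder of height $n$ is the digraph on the $2(n+1)$ distinct vertices $a_0,\dots,a_n,b_0,\dots,b_n$ with exactly the arcs $a_0a_1,a_1a_2,\dots,a_{n-1}a_n$, $\;b_0b_1,b_1b_2,\dots,b_{n-1}b_n$, and $b_0a_1,b_1a_2,\dots,b_{n-1}a_n$ (where $uv$ denotes an arc from $u$ to $v$). For a digraph $H$ with arc set $A(H)$, an operation $f:V(H)^m\to V(H)$ is a polymorphism of $H$ if $f(u_1,\dots,u_m)f(v_1,\dots,v_m)\in A(H)$ whenever $u_1v_1,\dots,u_mv_m\in A(H)$. It is conservative if $f(v_1,\dots,v_m)\in\{v_1,\dots,v_m\}$ for all $v_1,\dots,v_m$. A sequence $f_1,\dots,f_k$ of ternary operations on $V(H)$ is a Hagemann-Mitschke chain of length $k$ if for all $x,y$: $f_1(x,y,y)=x$; $f_i(x,x,y)=f_{i+1}(x,y,y)$ for all $1\le i\le k-1$; and $f_k(x,x,y)=y$. $H$ admits a Hagemann-Mitschke chain of conservative polymorphisms of length $k$ if there is such a chain in which every $f_i$ is a conservative polymorphism of $H$. -}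

module Defs where

open import Data.Nat using (ℕ; suc; _≤_)
open import Data.Fin using (Fin; suc; toℕ; inject₁)
open import Data.Vec using (Vec; []; _∷_)
open import Data.Vec.Membership.Propositional using (_∈_)
open import Data.Vec.Relation.Binary.Pointwise.Inductive using (Pointwise)
open import Data.Product using (Σ; _×_)
open import Level using (0ℓ)
open import Relation.Binary.Core using (Rel)
open import Relation.Binary.PropositionalEquality using (_≡_)

record Digraph : Set₁ where
  field
    Vertex : Set
    Arc    : Rel Vertex 0ℓ

open Digraph public

Operation : ℕ → Set → Set
Operation m V = Vec V m → V

IsPolymorphism : (H : Digraph) {m : ℕ} → Operation m (Vertex H) → Set
IsPolymorphism H f = ∀ {us vs} → Pointwise (Arc H) us vs → Arc H (f us) (f vs)

IsConservative : {V : Set} {m : ℕ} → Operation m V → Set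
IsConservative f = ∀ vs → f vs ∈ vs

-- The sequence f₁, …, f_k is indexed from 0: f i stands for f_{i+1}.
-- The field 1≤k is needed because for k = 0 the identities would be vacuous.
record IsHagemannMitschkeChain {V : Set} (k : ℕ) (f : Fin k → Operation 3 V) : Set where
  field
    1≤k   : 1 ≤ k
    first : ∀ i → toℕ i ≡ 0 → ∀ x y → f i (x ∷ y ∷ y ∷ []) ≡ x
    step  : ∀ i j → toℕ j ≡ suc (toℕ i) →
            ∀ x y → f i (x ∷ x ∷ y ∷ []) ≡ f j (x ∷ y ∷ y ∷ [])
    last  : ∀ i → suc (toℕ i) ≡ k → ∀ x y → f i (x ∷ x ∷ y ∷ []) ≡ y

AdmitsConservativeHMChain : Digraph → ℕ → Set
AdmitsConservativeHMChain H k =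
  Σ (Fin k → Operation 3 (Vertex H)) λ f →
    IsHagemannMitschkeChain k f ×
    (∀ i → IsPolymorphism H (f i) × IsConservative (f i))

data LadderVertex (n : ℕ) : Set where
  a b : Fin (suc n) → LadderVertex n

data LadderArc (n : ℕ) : Rel (LadderVertex n) 0ℓ where
  aa : (i : Fin n) → LadderArc n (a (inject₁ i)) (a (suc i))
  bb : (i : Fin n) → LadderArc n (b (inject₁ i)) (b (suc i))
  ba : (i : Fin n) → LadderArc n (b (inject₁ i)) (a (suc i))

ladder : ℕ → Digraph
ladder n = record { Vertex = LadderVertex n ; Arc = LadderArc n }

{-# OPTIONS --safe #-}

-- A ladder is levelled, and within a level b < a: there is an arc from u to v
-- exactly when v is one level above u and label u ≤ label v (b = false, a = true).
--
-- Lower bound: the only arc into b_{l+1} comes from b_l, so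
-- f_i(b_{l+1}, a_{l+1}, a_{l+1}) = b_{l+1} forces f_i(b_l, b_l, a_l) = b_l, which is
-- f_{i+1}(b_l, a_l, a_l).  Each step of the chain thus costs one level, and a chain of
-- length n still has f_n(b_0, b_0, a_0) = b_0, against f_n(x, x, y) = y.
--
-- Upper bound: every f_i picks its first or its third argument.  For arguments on one
-- common level the choice is dictated by thresholds on the level that move by one from
-- f_i to f_{i+1}; otherwise it depends only on which levels agree, which arcs preserve.
module Submission where

open import Data.Bool using (Bool; true; false; T; if_then_else_; f≤t; b≤b)
  renaming (_≤_ to _≤ᴮ_)
open import Data.Bool.Properties using (≤-minimum; ≤-maximum; if-float)
open import Data.Fin using (Fin; zero; suc; toℕ; inject₁; fromℕ; fromℕ<; lower₁)
open import Data.Fin.Properties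
  using (toℕ-injective; toℕ-inject₁; toℕ-fromℕ; toℕ-fromℕ<; toℕ≤pred[n]; inject₁-lower₁; toℕ-lower₁; toℕ<n)
open import Data.Nat
  using (ℕ; zero; suc; _+_; _≤_; _<_; z≤n; s≤s; _≡ᵇ_; _<ᵇ_; _≟_; _<?_)
open import Data.Nat.Properties
  using (+-suc; +-comm; m≤m+n; m≤n+m; ≤-reflexive; ≤-trans;
         <-irrefl; ≤⇒≯; n≤1+n; suc-injective; ≡ᵇ⇒≡)
open import Data.Product using (_×_; _,_; proj₁)
open import Data.Unit using (tt)
open import Data.Vec using ([]; _∷_)
open import Data.Vec.Relation.Binary.Pointwise.Inductive using ([]; _∷_)
open import Data.Vec.Relation.Unary.Any using (here; there)
open import Relation.Binary.PropositionalEquality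
  using (_≡_; refl; sym; trans; cong; subst)
open import Relation.Nullary using (¬_)
open import Relation.Nullary.Decidable using (dec-true; dec-false)
open import Defs

private
  variable
    n : ℕ

  -- Arcs in terms of levels and labels

  level : LadderVertex n → ℕ
  level (a l) = toℕ l
  level (b l) = toℕ l

  label : LadderVertex n → Bool
  label (a _) = true
  label (b _) = false

  vertex-≡ : {x y : LadderVertex n} → level x ≡ level y → label x ≡ label y → x ≡ y
  vertex-≡ {x = a _} {a _} p _ = cong a (toℕ-injective p)
  vertex-≡ {x = b _} {b _} p _ = cong b (toℕ-injective p)

  arc-level : {x y : LadderVertex n} → LadderArc n x y → level y ≡ suc (level x)
  arc-level (aa i) = cong suc (sym (toℕ-inject₁ i))
  arc-level (bb i) = cong suc (sym (toℕ-inject₁ i))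
  arc-level (ba i) = cong suc (sym (toℕ-inject₁ i))

  arc-label : {x y : LadderVertex n} → LadderArc n x y → label x ≤ᴮ label y
  arc-label (aa _) = b≤b
  arc-label (bb _) = b≤b
  arc-label (ba _) = f≤t

  toℕ-pred : {k l : Fin (suc n)} {i : Fin n} → toℕ l ≡ suc (toℕ k) → l ≡ suc i → k ≡ inject₁ i
  toℕ-pred {i = i} p refl = toℕ-injective (trans (sym (suc-injective p)) (sym (toℕ-inject₁ i)))

  arc-intro : {x y : LadderVertex n} → level y ≡ suc (level x) → label x ≤ᴮ label y →
              LadderArc n x y
  arc-intro {x = a _} {a (suc i)} p _ rewrite toℕ-pred p refl = aa i
  arc-intro {x = b _} {b (suc i)} p _ rewrite toℕ-pred p refl = bb i
  arc-intro {x = b _} {a (suc i)} p _ rewrite toℕ-pred p refl = ba i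
  arc-intro {x = a _} {b _}       p ()

  -- Choice by thresholds on a single level

  <ᵇ-suc : ∀ k m → (k <ᵇ m) ≤ᴮ (k <ᵇ suc m)
  <ᵇ-suc zero    zero    = f≤t
  <ᵇ-suc zero    (suc m) = b≤b
  <ᵇ-suc (suc k) zero    = ≤-minimum _
  <ᵇ-suc (suc k) (suc m) = <ᵇ-suc k m

  suc-<ᵇ : ∀ k m → (suc k <ᵇ m) ≤ᴮ (k <ᵇ m)
  suc-<ᵇ k zero    = b≤b
  suc-<ᵇ k (suc m) = <ᵇ-suc k m

  if-false-true-antitone : ∀ {x y} → x ≤ᴮ y →
                           (if y then false else true) ≤ᴮ (if x then false else true)
  if-false-true-antitone f≤t = f≤t
  if-false-true-antitone b≤b = b≤b

  if-true-false-monotone : ∀ {x y} → x ≤ᴮ y →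
                           (if x then true else false) ≤ᴮ (if y then true else false)
  if-true-false-monotone f≤t = f≤t
  if-true-false-monotone b≤b = b≤b

  -- Whether f_{i+1} picks the first argument, for arguments on level l labelled p, q, r
  -- (passed as p, r, q, so that the clauses split on q last).  If p = r it does not matter.
  levelRule : (n i l : ℕ) (p r q : Bool) → Bool
  levelRule n i l false true  false = i + l <ᵇ n
  levelRule n i l false true  true  = i + l <ᵇ suc n
  levelRule n i l true  false true  = i <ᵇ l
  levelRule n i l true  false false = i <ᵇ suc l
  levelRule n i l false false _     = true
  levelRule n i l true  true  _     = true

  levelOp : (n i l : ℕ) (p r q : Bool) → Bool
  levelOp n i l p r q = if levelRule n i l p r q then p else r

  -- Going up a level makes `i + l < n` harder and `i < l` easier, so either choice can only raise
  -- the label. The thresholds for the two values of `q` differ by one, so raising the level and `q`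
  -- together leaves the choice unchanged. If just one of `p`, `r` rises, the lower label is `false`
  -- or the upper one is `true`.
  levelOp-mono : ∀ n i l {p q r p′ q′ r′} → p ≤ᴮ p′ → r ≤ᴮ r′ → q ≤ᴮ q′ →
                 levelOp n i l p r q ≤ᴮ levelOp n i (suc l) p′ r′ q′
  levelOp-mono n i l (b≤b {false}) (b≤b {false}) _ = b≤b
  levelOp-mono n i l (b≤b {true})  (b≤b {true})  _ = b≤b
  levelOp-mono n i l (b≤b {false}) f≤t _ = ≤-minimum _
  levelOp-mono n i l f≤t (b≤b {false}) _ = ≤-minimum _
  levelOp-mono n i l f≤t f≤t _ = f≤t
  levelOp-mono n i l (b≤b {true}) f≤t _ = ≤-maximum _
  levelOp-mono n i l f≤t (b≤b {true}) _ = ≤-maximum _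
  levelOp-mono n i l (b≤b {false}) (b≤b {true}) (b≤b {false})
    rewrite +-suc i l = if-false-true-antitone (suc-<ᵇ (i + l) n)
  levelOp-mono n i l (b≤b {false}) (b≤b {true}) (b≤b {true})
    rewrite +-suc i l = if-false-true-antitone (suc-<ᵇ (i + l) (suc n))
  levelOp-mono n i l (b≤b {false}) (b≤b {true}) f≤t rewrite +-suc i l = b≤b
  levelOp-mono n i l (b≤b {true}) (b≤b {false}) (b≤b {false}) =
    if-true-false-monotone (<ᵇ-suc i (suc l))
  levelOp-mono n i l (b≤b {true}) (b≤b {false}) (b≤b {true}) =
    if-true-false-monotone (<ᵇ-suc i l)
  levelOp-mono n i l (b≤b {true}) (b≤b {false}) f≤t = b≤b

  -- The Boolean arguments xy and yz tell whether the levels of x, y and of y, z agree.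
  rule : ℕ → (xy yz : Bool) (x y z : LadderVertex n) → Bool
  rule {n} i true  true  x y z = levelRule n i (level x) (label x) (label z) (label y)
  rule     i false true  _ _ _ = i ≡ᵇ 0
  rule     i _     false _ _ _ = false

  picksFirst : ℕ → (x y z : LadderVertex n) → Bool
  picksFirst i x y z = rule i (level x ≡ᵇ level y) (level y ≡ᵇ level z) x y z

  op : ℕ → Operation 3 (LadderVertex n)
  op i (x ∷ y ∷ z ∷ []) = if picksFirst i x y z then x else z

  ≡ᵇ-refl : ∀ m → (m ≡ᵇ m) ≡ true
  ≡ᵇ-refl m = dec-true (m ≟ m) refl

  op-conservative : ∀ i → IsConservative (op {n} i)
  op-conservative i (x ∷ y ∷ z ∷ []) with picksFirst i x y z
  ... | true  = here refl
  ... | false = there (there (here refl))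

  level-if : ∀ c (x z : LadderVertex n) → level x ≡ level z →
             level (if c then x else z) ≡ level x
  level-if true  _ _ _ = refl
  level-if false _ _ p = sym p

  -- The rule may pick the first coordinate at one end and the third at the other, so the arc is
  -- rebuilt from its level and label conditions.
  levelRule-arc : ∀ i {x y z x′ y′ z′ : LadderVertex n} →
    LadderArc n x x′ → LadderArc n y y′ → LadderArc n z z′ → level x ≡ level z →
    LadderArc n (if levelRule n i (level x) (label x) (label z) (label y) then x else z)
                (if levelRule n i (level x′) (label x′) (label z′) (label y′) then x′ else z′)
  levelRule-arc {n} i {x} {y} {z} {x′} {y′} {z′} xx′ yy′ zz′ x≡z
    rewrite arc-level xx′ = arc-intro level-suc label-≤
    where
    c c′ : Bool
    c  = levelRule n i (level x) (label x) (label z) (label y)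
    c′ = levelRule n i (suc (level x)) (label x′) (label z′) (label y′)
    x′≡z′ : level x′ ≡ level z′
    x′≡z′ = trans (arc-level xx′) (trans (cong suc x≡z) (sym (arc-level zz′)))
    level-suc : level (if c′ then x′ else z′) ≡ suc (level (if c then x else z))
    level-suc = trans (level-if c′ x′ z′ x′≡z′)
      (trans (arc-level xx′) (cong suc (sym (level-if c x z x≡z))))
    label-≤ : label (if c then x else z) ≤ᴮ label (if c′ then x′ else z′)
    label-≤ rewrite if-float label c {x} {z} | if-float label c′ {x′} {z′} =
      levelOp-mono n i (level x) (arc-label xx′) (arc-label zz′) (arc-label yy′)

  ≡ᵇ-true⇒≡ : ∀ {k l} → (k ≡ᵇ l) ≡ true → k ≡ l
  ≡ᵇ-true⇒≡ p = ≡ᵇ⇒≡ _ _ (subst T (sym p) tt)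

  -- Arcs raise every level by one, so the level tests agree at both ends. Unless all three levels
  -- coincide, both ends pick the same coordinate.
  op-polymorphism : ∀ i → IsPolymorphism (ladder n) (op i)
  op-polymorphism {n} i {x ∷ y ∷ z ∷ []} {x′ ∷ y′ ∷ z′ ∷ []} (xx′ ∷ yy′ ∷ zz′ ∷ [])
    rewrite arc-level xx′ | arc-level yy′ | arc-level zz′
    with level x ≡ᵇ level y in eq₁ | level y ≡ᵇ level z in eq₂
  ... | true  | true = levelRule-arc i xx′ yy′ zz′ (trans (≡ᵇ-true⇒≡ eq₁) (≡ᵇ-true⇒≡ eq₂))
  ... | false | true with i
  ...   | zero  = xx′
  ...   | suc _ = zz′
  op-polymorphism i (xx′ ∷ yy′ ∷ zz′ ∷ []) | true  | false = zz′
  op-polymorphism i (xx′ ∷ yy′ ∷ zz′ ∷ []) | false | false = zz′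

  -- Chain identities

  op-first : ∀ (x y : LadderVertex n) → op 0 (x ∷ y ∷ y ∷ []) ≡ x
  op-first {n} x y rewrite ≡ᵇ-refl (level y) with level x ≡ᵇ level y
  ... | false = refl
  ... | true with x | y
  ...   | a _ | a _ = refl
  ...   | a _ | b _ = refl
  ...   | b _ | b _ = refl
  -- For `i = 0` the threshold `0 < suc l` computes, but `l < suc n` needs the bound on levels.
  ...   | b l | a _ rewrite dec-true (toℕ l <? suc n) (s≤s (toℕ≤pred[n] l)) = refl

  -- On different levels both sides are `y`. On one level, the thresholds match by computation:
  -- `i + l < n` with `suc i + l < suc n`, and `i < l` with `suc i < suc l`.
  op-step : ∀ i (x y : LadderVertex n) → op i (x ∷ x ∷ y ∷ []) ≡ op (suc i) (x ∷ y ∷ y ∷ [])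
  op-step i x y rewrite ≡ᵇ-refl (level x) | ≡ᵇ-refl (level y) with level x ≡ᵇ level y
  ... | false = refl
  ... | true with x | y
  ...   | a _ | a _ = refl
  ...   | a _ | b _ = refl
  ...   | b _ | a _ = refl
  ...   | b _ | b _ = refl

  op-last : ∀ (x y : LadderVertex n) → op n (x ∷ x ∷ y ∷ []) ≡ y
  op-last {n} x y rewrite ≡ᵇ-refl (level x) with level x ≡ᵇ level y in eq
  ... | false = refl
  ... | true with x | y
  ...   | a k | a l = vertex-≡ (≡ᵇ-true⇒≡ eq) refl
  ...   | b k | b l = vertex-≡ (≡ᵇ-true⇒≡ eq) refl
  -- For `i = n` both `n < l` and `n + l < n` fail on every level, so the third argument is picked.
  ...   | a k | b _ rewrite dec-false (n <? toℕ k) (≤⇒≯ (toℕ≤pred[n] k)) = refl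
  ...   | b k | a _ rewrite dec-false (n + toℕ k <? n) (≤⇒≯ (m≤m+n n (toℕ k))) = refl

  hmChain : (n : ℕ) → AdmitsConservativeHMChain (ladder n) (suc n)
  hmChain n = (λ i → op (toℕ i)) , record
    { 1≤k   = s≤s z≤n
    ; first = λ { zero _ → op-first }
    ; step  = λ i j j≡1+i x y →
        trans (op-step (toℕ i) x y) (cong (λ m → op m (x ∷ y ∷ y ∷ [])) (sym j≡1+i))
    ; last  = λ i 1+i≡1+n x y →
        trans (cong (λ m → op m (x ∷ x ∷ y ∷ [])) (suc-injective 1+i≡1+n)) (op-last x y)
    } , λ i → op-polymorphism (toℕ i) , op-conservative (toℕ i)

  -- Lower bound on the chain length

  bb-pred : {x : LadderVertex n} {l : Fin n} → LadderArc n x (b (suc l)) → x ≡ b (inject₁ l)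
  bb-pred (bb _) = refl

  polymorphism-descends : {f : Operation 3 (LadderVertex n)} → IsPolymorphism (ladder n) f →
    ∀ (l : Fin n) → f (b (suc l) ∷ a (suc l) ∷ a (suc l) ∷ []) ≡ b (suc l) →
    f (b (inject₁ l) ∷ b (inject₁ l) ∷ a (inject₁ l) ∷ []) ≡ b (inject₁ l)
  polymorphism-descends {n} poly l p =
    bb-pred (subst (LadderArc n _) p (poly (bb l ∷ ba l ∷ aa l ∷ [])))

  module _ {k : ℕ} {f : Fin k → Operation 3 (LadderVertex n)}
           (chain : IsHagemannMitschkeChain k f)
           (poly : ∀ i → IsPolymorphism (ladder n) (f i)) where
    open IsHagemannMitschkeChain chain

    -- Induction on `m`: index `suc m` on level `l` reduces, by `step` and one descent, to index `m`
    -- on level `l + 1`. The sum of index and level is kept, so the induction stays inside the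
    -- ladder.
    chain-low-level : ∀ m (i : Fin k) → toℕ i ≡ m → ∀ l → m + toℕ l ≤ n →
                      f i (b l ∷ a l ∷ a l ∷ []) ≡ b l
    chain-low-level zero    i i≡0   l _  = first i i≡0 (b l) (a l)
    chain-low-level (suc m) j j≡1+m l 1+m+l≤n =
      trans (sym (step i j (trans j≡1+m (cong suc (sym i≡m))) (b l) (a l)))
        (subst (λ h → f i (b h ∷ b h ∷ a h ∷ []) ≡ b h) (inject₁-lower₁ l n≢l)
          (polymorphism-descends (poly i) l′
            (chain-low-level m i i≡m (suc l′) m+1+l′≤n)))
      where
      m<k : m < k
      m<k = ≤-trans (≤-reflexive (sym j≡1+m)) (≤-trans (n≤1+n (toℕ j)) (toℕ<n j))
      i : Fin k
      i = fromℕ< m<k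
      i≡m : toℕ i ≡ m
      i≡m = toℕ-fromℕ< m<k
      -- `l` is not the top level, so `lower₁` applies and `suc l′` is the level above.
      n≢l : ¬ n ≡ toℕ l
      n≢l n≡l = <-irrefl (sym n≡l) (≤-trans (s≤s (m≤n+m (toℕ l) m)) 1+m+l≤n)
      l′ : Fin n
      l′ = lower₁ l n≢l
      m+1+l′≤n : m + suc (toℕ l′) ≤ n
      m+1+l′≤n rewrite toℕ-lower₁ l n≢l | +-suc m (toℕ l) = 1+m+l≤n

  no-short-hmChain : (n : ℕ) → ¬ AdmitsConservativeHMChain (ladder n) n
  no-short-hmChain zero (_ , chain , _) with () ← IsHagemannMitschkeChain.1≤k chain
  no-short-hmChain (suc n) (f , chain , props) = a≢b (trans (sym at-a) at-b)
    where
    m : Fin (suc n)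
    m = fromℕ n
    poly : ∀ i → IsPolymorphism (ladder (suc n)) (f i)
    poly i = proj₁ (props i)
    at-a : f m (b zero ∷ b zero ∷ a zero ∷ []) ≡ a zero
    at-a = IsHagemannMitschkeChain.last chain m (cong suc (toℕ-fromℕ n)) (b zero) (a zero)
    at-b : f m (b zero ∷ b zero ∷ a zero ∷ []) ≡ b zero
    at-b = polymorphism-descends (poly m) zero
      -- The last index is `n` and the height `suc n`, so level 1 just meets the bound; one more
      -- descent reaches level 0.
      (chain-low-level chain poly n m (toℕ-fromℕ n) (suc zero) (≤-reflexive (+-comm n 1)))
    a≢b : ¬ a zero ≡ b zero
    a≢b ()

theorem6p4 : (n : ℕ) → 1 ≤ n →
    AdmitsConservativeHMChain (ladder n) (suc n) ×
    ¬ AdmitsConservativeHMChain (ladder n) n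
theorem6p4 n _ = hmChain n , no-short-hmChain n
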